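{- Let $(X,d)$ be a separable metric space without isolated points and let $M$ be a defining structure of $(X,d)$ in the language $\mathcal{L}$. Let $V_1$ and $V_2$ be two independent dense subsets of $X$. Suppose thickness is definable in $M$ and $G_1=(V_1,E_1)$, $G_2=(V_2,E_2)$ are g.e.c. graphs in $(X,d)$. Then $(G_1)_{\mathrm{ind}}$ and $(G_2)_{\mathrm{ind}}$ are elementarily equivalent in $\mathcal{L}_{\mathrm{ind}}^{E}$ (and hence also in the graph language $\mathcal{L}_G=\{E\}$ and in $\mathcal{L}_{\mathrm{ind}}$). Moreover, both $(V_1)_{\mathrm{ind}}$ and $(G_1)_{\mathrm{ind}}$ have quantifier elimination (in the languages $\mathcal{L}_{\mathrm{ind}}$ and $\mathcal{L}_{\mathrm{ind}}^E$ respectively).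
   Context: Let $(X,d)$ be a separable metric space without isolated points. Defining structure: an $\mathcal{L}$-structure $M$ is a defining structure of $(X,d)$ if $X\subseteq M^n$ is an $\mathcal{L}$-definable set for some $n\in\mathbb{N}$ and the binary relation $d(x,y)<1$ on $X$ is $\mathcal{L}$-definable over $\emptyset$. Elements of $X$ are thus $n$-tuples of $M$; variables "in the sort of $X$" are $n$-tuples of variables ranging over $X$, and $\varphi(X,\bar b)=\{x\in X: M\models\varphi(x,\bar b)\}$. Thick/thin: a definable subset $A\subseteq X$ is thick if it contains a non-empty open ball of $(X,d)$; otherwise it is thin. Thickness is definable in $M$ if for every $\mathcal{L}$-formula $\varphi(x,y)$ without parameters, with $|x|=n$ and $|y|=mn$, there is a formula $\psi(y)$ without parameters such that for every $\bar b\in X^m$: $M\models\psi(\bar b)$ iff $\varphi(X,\bar b)$ is thick. Independent: a subset $Y\subseteq X$ is independent if for every $\mathcal{L}$-formula $\varphi(x,y)$ with $|x|=n$, $|y|=mn$, $m\in\mathbb{N}$, and every $\bar b\in Y^m$, if $\varphi(X,\bar b)$ is thin then $Y\cap\varphi(X,\bar b)\subseteq\bar b$ (the set of entries of $\bar b$). g.e.c.: a (simple, undirected) graph $G$ with vertex set a dense $S\subseteq X$ is geometrically existentially closed if (i) any two adjacent $u,v\in S$ satisfy $d(u,v)<1$; and (ii) for any $s\in S$, any disjoint finite $A,B\subseteq S$ contained in the open unit ball $B_1(s)$, and any $\epsilon>0$, there is $v\in S\setminus(A\cup B)$ with $d(s,v)<\epsilon$ adjacent to every vertex in $A$ and to no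 vertex in $B$. Induced structures: let $\mathcal{L}_{\mathrm{ind}}=\{R_\phi:\phi(x_1,\ldots,x_k)\in\mathcal{L},\ x_i\text{ variables in the sort of }X\}$, with $R_\phi$ a $k$-ary relation symbol, and $\mathcal{L}_{\mathrm{ind}}^E=\mathcal{L}_{\mathrm{ind}}\cup\{E\}$. For a graph $G=(V,E)$ with $V\subseteq X$, $V_{\mathrm{ind}}$ is the $\mathcal{L}_{\mathrm{ind}}$-structure and $G_{\mathrm{ind}}$ the $\mathcal{L}_{\mathrm{ind}}^E$-structure with universe $V$, where $R_\phi$ is interpreted as $\{(a_1,\ldots,a_k)\in V^k: M\models\phi(a_1,\ldots,a_k)\}$ and $E$ is the edge relation. A structure has quantifier elimination if its complete theory does. -}

module Defs where

open import Level using (Level; suc)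
import Algebra.Bundles as Algebra
import Algebra.Properties.CommutativeSemigroup as CommutativeSemigroup
open import Data.Empty.Polymorphic using (⊥)
open import Data.Fin.Base using (Fin)
open import Data.List.Base using (List)
import Data.List.Membership.Setoid as ListMembership
import Data.List.Relation.Binary.Disjoint.Setoid as ListDisjoint
import Data.List.Relation.Unary.All as ListAll
open import Data.Nat.Base as ℕ using (ℕ)
import Data.Nat.Properties as ℕ
open import Data.Product.Base using (∃; ∃-syntax; Σ-syntax; _×_; _,_; proj₁; proj₂)
open import Data.Rational.Base as ℚ using (ℚ; 0ℚ; 1ℚ; ½)
import Data.Rational.Properties as ℚ
open import Data.Vec.Base as Vec using (Vec; []; _∷_; _++_; concat; lookup)
import Data.Vec.Membership.Setoid as VecMembership
open import Data.Vec.Relation.Binary.Pointwise.Inductive as Pointwise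
  using (Pointwise; []; _∷_)
import Data.Vec.Relation.Unary.All as VecAll
open import Function.Base using (_∘_; id)
open import Function.Bundles using (_⇔_; mk⇔; Injection; Equivalence)
import Function.Metric.Structures as Metric
open import Relation.Binary.Bundles using (Setoid)
open import Relation.Binary.Core using (Rel)
open import Relation.Binary.Definitions
  using (Irreflexive; Symmetric; Reflexive; Transitive; _Respects₂_)
open import Relation.Binary.Structures using (IsPartialOrder)
import Relation.Binary.Construct.On as On
open import Relation.Binary.PropositionalEquality as ≡ using (_≡_)
open import Relation.Nullary.Negation using (¬_)
open import Relation.Unary using (Pred)

private
  variable
    ℓ : Level
    k : ℕ

-- Real numbers as Cauchy sequences of rationals, compared up to _≃_.

record ℝ : Set where
  field
    seq    : ℕ → ℚ
    cauchy : ∀ ε → 0ℚ ℚ.< ε →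
             ∃[ N ] (∀ i j → N ℕ.≤ i → N ℕ.≤ j → ℚ.∣ seq i ℚ.- seq j ∣ ℚ.< ε)

open ℝ public

infix 4 _≤_ _<_ _≃_
infixl 6 _+_

_≤_ : Rel ℝ _
x ≤ y = ∀ ε → 0ℚ ℚ.< ε →
        ∃[ N ] (∀ i → N ℕ.≤ i → seq x i ℚ.≤ seq y i ℚ.+ ε)

_<_ : Rel ℝ _
x < y = ∃[ ε ] 0ℚ ℚ.< ε ×
        ∃[ N ] (∀ i → N ℕ.≤ i → seq x i ℚ.+ ε ℚ.≤ seq y i)

_≃_ : Rel ℝ _
x ≃ y = x ≤ y × y ≤ x

fromℚ : ℚ → ℝ
fromℚ q .seq _ = q
fromℚ q .cauchy ε 0<ε = 0 , λ _ _ _ _ →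
  ≡.subst (λ p → ℚ.∣ p ∣ ℚ.< ε) (≡.sym (ℚ.+-inverseʳ q)) 0<ε

0ℝ 1ℝ : ℝ
0ℝ = fromℚ 0ℚ
1ℝ = fromℚ 1ℚ

private
  half-pos : ∀ {ε} → 0ℚ ℚ.< ε → 0ℚ ℚ.< ½ ℚ.* ε
  half-pos {ε} 0<ε =
    ≡.subst (ℚ._< ½ ℚ.* ε) (ℚ.*-zeroʳ ½) (ℚ.*-monoʳ-<-pos ½ 0<ε)

  halves : ∀ ε → ½ ℚ.* ε ℚ.+ ½ ℚ.* ε ≡ ε
  halves ε = ≡.trans (≡.sym (ℚ.*-distribʳ-+ ε ½ ½)) (ℚ.*-identityˡ ε)

  interchange : ∀ a b c d →
    (a ℚ.+ b) ℚ.- (c ℚ.+ d) ≡ (a ℚ.- c) ℚ.+ (b ℚ.- d)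
  interchange a b c d =
    ≡.trans (≡.cong ((a ℚ.+ b) ℚ.+_) (ℚ.neg-distrib-+ c d))
            (+-medial a b (ℚ.- c) (ℚ.- d))
    where
    open CommutativeSemigroup
      (Algebra.CommutativeMonoid.commutativeSemigroup ℚ.+-0-commutativeMonoid)
      using () renaming (interchange to +-medial)

_+_ : ℝ → ℝ → ℝ
(x + y) .seq i = seq x i ℚ.+ seq y i
(x + y) .cauchy ε 0<ε =
  let M , p = cauchy x _ (half-pos 0<ε)
      N , q = cauchy y _ (half-pos 0<ε)
  in M ℕ.⊔ N , λ i j i≥ j≥ → begin-strict
    ℚ.∣ (seq x i ℚ.+ seq y i) ℚ.- (seq x j ℚ.+ seq y j) ∣
      ≡⟨ ≡.cong ℚ.∣_∣ (interchange (seq x i) (seq y i) (seq x j) (seq y j)) ⟩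
    ℚ.∣ (seq x i ℚ.- seq x j) ℚ.+ (seq y i ℚ.- seq y j) ∣
      ≤⟨ ℚ.∣p+q∣≤∣p∣+∣q∣ (seq x i ℚ.- seq x j) (seq y i ℚ.- seq y j) ⟩
    ℚ.∣ seq x i ℚ.- seq x j ∣ ℚ.+ ℚ.∣ seq y i ℚ.- seq y j ∣
      <⟨ ℚ.+-mono-< (p i j (ℕ.m⊔n≤o⇒m≤o M N i≥) (ℕ.m⊔n≤o⇒m≤o M N j≥))
                    (q i j (ℕ.m⊔n≤o⇒n≤o M N i≥) (ℕ.m⊔n≤o⇒n≤o M N j≥)) ⟩
    ½ ℚ.* ε ℚ.+ ½ ℚ.* ε
      ≡⟨ halves ε ⟩
    ε ∎
  where open ℚ.≤-Reasoning

≤-refl : Reflexive _≤_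
≤-refl {x} ε 0<ε = 0 , λ i _ →
  ≡.subst (ℚ._≤ seq x i ℚ.+ ε) (ℚ.+-identityʳ (seq x i))
          (ℚ.+-monoʳ-≤ (seq x i) (ℚ.<⇒≤ 0<ε))

≤-trans : Transitive _≤_
≤-trans {x} {y} {z} x≤y y≤z ε 0<ε =
  let M , p = x≤y _ (half-pos 0<ε)
      N , q = y≤z _ (half-pos 0<ε)
  in M ℕ.⊔ N , λ i i≥ → begin
    seq x i
      ≤⟨ p i (ℕ.m⊔n≤o⇒m≤o M N i≥) ⟩
    seq y i ℚ.+ ½ ℚ.* ε
      ≤⟨ ℚ.+-monoˡ-≤ (½ ℚ.* ε) (q i (ℕ.m⊔n≤o⇒n≤o M N i≥)) ⟩
    seq z i ℚ.+ ½ ℚ.* ε ℚ.+ ½ ℚ.* ε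
      ≡⟨ ℚ.+-assoc (seq z i) (½ ℚ.* ε) (½ ℚ.* ε) ⟩
    seq z i ℚ.+ (½ ℚ.* ε ℚ.+ ½ ℚ.* ε)
      ≡⟨ ≡.cong (seq z i ℚ.+_) (halves ε) ⟩
    seq z i ℚ.+ ε ∎
  where open ℚ.≤-Reasoning

≤-isPartialOrder : IsPartialOrder _≃_ _≤_
≤-isPartialOrder = record
  { isPreorder = record
    { isEquivalence = record
      { refl  = λ {x} → ≤-refl {x} , ≤-refl {x}
      ; sym   = λ (p , q) → q , p
      ; trans = λ {x} {y} {z} (p , q) (r , s) →
                  ≤-trans {x} {y} {z} p r , ≤-trans {z} {y} {x} s q
      }
    ; reflexive = proj₁
    ; trans     = λ {x} {y} {z} → ≤-trans {x} {y} {z}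
    }
  ; antisym = _,_
  }

-- Subsets of X are predicates; points are identified up to _≈_.

record MetricSpace ℓ : Set (suc ℓ) where
  field
    setoid : Setoid ℓ ℓ

  open Setoid setoid public using (Carrier; _≈_)

  field
    d        : Carrier → Carrier → ℝ
    isMetric : Metric.IsGeneralMetric _≈_ _≃_ _≤_ 0ℝ _+_ d

subsetoid : (S : Setoid ℓ ℓ) → Pred (Setoid.Carrier S) ℓ → Setoid ℓ ℓ
subsetoid S V = On.setoid {B = ∃ V} S proj₁

module _ (𝕏 : MetricSpace ℓ) where
  open MetricSpace 𝕏

  Ball : Carrier → ℝ → Pred Carrier _
  Ball c r x = d c x < r

  Dense : Pred Carrier ℓ → Set ℓ
  Dense S = ∀ x ε → 0ℝ < ε → ∃[ s ] S s × Ball x ε s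

  Countable : Pred Carrier ℓ → Set ℓ
  Countable S = Injection (subsetoid setoid S) (≡.setoid ℕ)

  Separable : Set (suc ℓ)
  Separable = ∃[ S ] Countable S × Dense S

  NoIsolatedPoints : Set ℓ
  NoIsolatedPoints = ∀ x ε → 0ℝ < ε → ∃[ y ] ¬ (x ≈ y) × Ball x ε y

  Thick : Pred Carrier ℓ → Set ℓ
  Thick A = ∃[ c ] ∃[ r ] 0ℝ < r × (∀ x → Ball c r x → A x)

  Thin : Pred Carrier ℓ → Set ℓ
  Thin A = ¬ Thick A

record Language ℓ : Set (suc ℓ) where
  field
    Func : ℕ → Set ℓ
    Rel′ : ℕ → Set ℓ

open Language public

module _ (L : Language ℓ) where

  data Term (k : ℕ) : Set ℓ where
    var : Fin k → Term k
    fun : ∀ {j} → Func L j → Vec (Term k) j → Term k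

  infix  7 _≐_
  infixr 6 _⇒_

  -- Formulas whose free variables are among the k variables of the
  -- context; ∀′ binds variable zero.  Classically the remaining
  -- connectives and ∃ are definable from these.
  data Formula (k : ℕ) : Set ℓ where
    ⊥′  : Formula k
    _≐_ : Term k → Term k → Formula k
    rel : ∀ {j} → Rel′ L j → Vec (Term k) j → Formula k
    _⇒_ : Formula k → Formula k → Formula k
    ∀′  : Formula (ℕ.suc k) → Formula k

  Sentence : Set ℓ
  Sentence = Formula 0

  data QuantifierFree {k : ℕ} : Formula k → Set ℓ where
    ⊥′  : QuantifierFree ⊥′
    _≐_ : ∀ s t → QuantifierFree (s ≐ t)
    rel : ∀ {j} (R : Rel′ L j) ts → QuantifierFree (rel R ts)
    _⇒_ : ∀ {φ ψ} → QuantifierFree φ → QuantifierFree ψ → QuantifierFree (φ ⇒ ψ)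

  -- The symbol = is interpreted by the equality of the domain setoid.
  record Structure : Set (suc ℓ) where
    field
      domain : Setoid ℓ ℓ

    open Setoid domain public using (Carrier; _≈_)

    field
      ⟦_⟧ᶠ     : ∀ {j} → Func L j → Vec Carrier j → Carrier
      ⟦_⟧ʳ     : ∀ {j} → Rel′ L j → Vec Carrier j → Set ℓ
      fun-cong : ∀ {j} (f : Func L j) {u v} → Pointwise _≈_ u v → ⟦ f ⟧ᶠ u ≈ ⟦ f ⟧ᶠ v
      rel-resp : ∀ {j} (R : Rel′ L j) {u v} → Pointwise _≈_ u v → ⟦ R ⟧ʳ u → ⟦ R ⟧ʳ v

module _ {L : Language ℓ} (M : Structure L) where
  open Structure M
  private module S = Setoid domain

  mutual
    eval : Vec Carrier k → Term L k → Carrier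
    eval v (var i)    = lookup v i
    eval v (fun f ts) = ⟦ f ⟧ᶠ (evals v ts)

    evals : ∀ {j} → Vec Carrier k → Vec (Term L k) j → Vec Carrier j
    evals v []       = []
    evals v (t ∷ ts) = eval v t ∷ evals v ts

  infix 4 _⊨_[_]

  _⊨_[_] : Formula L k → Vec Carrier k → Set ℓ
  _⊨_[_] ⊥′         v = ⊥
  _⊨_[_] (s ≐ t)    v = eval v s ≈ eval v t
  _⊨_[_] (rel R ts) v = ⟦ R ⟧ʳ (evals v ts)
  _⊨_[_] (φ ⇒ ψ)    v = _⊨_[_] φ v → _⊨_[_] ψ v
  _⊨_[_] (∀′ φ)     v = ∀ a → _⊨_[_] φ (a ∷ v)

  mutual
    eval-cong : ∀ {u v : Vec Carrier k} → Pointwise _≈_ u v →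
                ∀ t → eval u t ≈ eval v t
    eval-cong p (var i)    = Pointwise.lookup p i
    eval-cong p (fun f ts) = fun-cong f (evals-cong p ts)

    evals-cong : ∀ {j} {u v : Vec Carrier k} → Pointwise _≈_ u v →
                 (ts : Vec (Term L k) j) → Pointwise _≈_ (evals u ts) (evals v ts)
    evals-cong p []       = []
    evals-cong p (t ∷ ts) = eval-cong p t ∷ evals-cong p ts

  ⊨-cong : ∀ {u v : Vec Carrier k} → Pointwise _≈_ u v →
           ∀ φ → _⊨_[_] φ u ⇔ _⊨_[_] φ v
  ⊨-cong p ⊥′         = mk⇔ id id
  ⊨-cong p (s ≐ t)    = mk⇔
    (λ e → S.trans (S.sym (eval-cong p s)) (S.trans e (eval-cong p t)))
    (λ e → S.trans (eval-cong p s) (S.trans e (S.sym (eval-cong p t))))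
  ⊨-cong p (rel R ts) = mk⇔
    (rel-resp R (evals-cong p ts))
    (rel-resp R (Pointwise.sym S.sym (evals-cong p ts)))
  ⊨-cong p (φ ⇒ ψ)    = mk⇔
    (λ h → Equivalence.to   (⊨-cong p ψ) ∘ h ∘ Equivalence.from (⊨-cong p φ))
    (λ h → Equivalence.from (⊨-cong p ψ) ∘ h ∘ Equivalence.to   (⊨-cong p φ))
  ⊨-cong p (∀′ φ)     = mk⇔
    (λ h a → Equivalence.to   (⊨-cong (S.refl ∷ p) φ) (h a))
    (λ h a → Equivalence.from (⊨-cong (S.refl ∷ p) φ) (h a))

  -- Definability with parameters.
  Definable : ∀ {n} → Pred (Vec Carrier n) ℓ → Set ℓ
  Definable {n} A = ∃[ j ] Σ[ φ ∈ Formula L (n ℕ.+ j) ] Σ[ c ∈ Vec Carrier j ]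
                    (∀ v → A v ⇔ _⊨_[_] φ (v ++ c))

Theory : Language ℓ → Set (suc ℓ)
Theory {ℓ} L = Pred (Sentence L) ℓ

module _ {L : Language ℓ} where

  Th : Structure L → Theory L
  Th M σ = M ⊨ σ [ [] ]

  ElementarilyEquivalent : Structure L → Structure L → Set ℓ
  ElementarilyEquivalent M N = ∀ σ → Th M σ ⇔ Th N σ

  Model : Theory L → Structure L → Set ℓ
  Model T N = ∀ σ → T σ → N ⊨ σ [ [] ]

  HasQE : Theory L → Set (suc ℓ)
  HasQE T = ∀ k (φ : Formula L k) →
    ∃[ ψ ] QuantifierFree L ψ ×
           (∀ N → Model T N → ∀ v → N ⊨ φ [ v ] ⇔ N ⊨ ψ [ v ])

  StructureHasQE : Structure L → Set (suc ℓ)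
  StructureHasQE M = HasQE (Th M)

record Graph (S : Setoid ℓ ℓ) : Set (suc ℓ) where
  open Setoid S using (Carrier; _≈_)
  field
    Adj    : Rel Carrier ℓ
    sym    : Symmetric Adj
    irrefl : Irreflexive _≈_ Adj
    resp   : Adj Respects₂ _≈_

∅ᴸ : Language ℓ
∅ᴸ = record { Func = λ _ → ⊥ ; Rel′ = λ _ → ⊥ }

data RelE (L : Language ℓ) : ℕ → Set ℓ where
  old : ∀ {j} → Rel′ L j → RelE L j
  E   : RelE L 2

_∪E : Language ℓ → Language ℓ
L ∪E = record { Func = Func L ; Rel′ = RelE L }

-- The language of graphs, with E as its only symbol.
Lᴳ : Language ℓ
Lᴳ = ∅ᴸ ∪E

bare : Setoid ℓ ℓ → Structure ∅ᴸ
bare S = record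
  { domain = S ; ⟦_⟧ᶠ = λ () ; ⟦_⟧ʳ = λ () ; fun-cong = λ () ; rel-resp = λ () }

module _ {L : Language ℓ} (M : Structure L) (G : Graph (Structure.domain M)) where
  open Structure M
  open Graph G

  private
    ⟦_⟧ᴱ : ∀ {j} → RelE L j → Vec Carrier j → Set ℓ
    ⟦ old R ⟧ᴱ v           = ⟦ R ⟧ʳ v
    ⟦ E     ⟧ᴱ (a ∷ b ∷ []) = Adj a b

    respᴱ : ∀ {j} (R : RelE L j) {u v} → Pointwise _≈_ u v → ⟦ R ⟧ᴱ u → ⟦ R ⟧ᴱ v
    respᴱ (old R) p            h = rel-resp R p h
    respᴱ E       (p ∷ q ∷ []) h = proj₁ resp q (proj₂ resp p h)

  expand : Structure (L ∪E)
  expand = record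
    { domain = domain ; ⟦_⟧ᶠ = ⟦_⟧ᶠ ; ⟦_⟧ʳ = ⟦_⟧ᴱ
    ; fun-cong = fun-cong ; rel-resp = respᴱ }

graphStructure : {S : Setoid ℓ ℓ} → Graph S → Structure Lᴳ
graphStructure {S = S} G = expand (bare S) G

-- X ⊆ Mⁿ is rendered by an injective map ι : X → Mⁿ with definable image.
record DefiningStructure (L : Language ℓ) (𝕏 : MetricSpace ℓ) : Set (suc ℓ) where
  open MetricSpace 𝕏 using (d) renaming (Carrier to X; _≈_ to _≈ˣ_)
  field
    M : Structure L
    n : ℕ

  open Structure M using (Carrier; _≈_)

  field
    ι           : X → Vec Carrier n
    ι-cong      : ∀ {x y} → x ≈ˣ y → Pointwise _≈_ (ι x) (ι y)
    ι-injective : ∀ {x y} → Pointwise _≈_ (ι x) (ι y) → x ≈ˣ y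
    X-definable : Definable M {n} (λ v → ∃[ x ] Pointwise _≈_ (ι x) v)

  -- A formula in k variables of the sort of X is a formula in k * n
  -- variables, grouped in k consecutive blocks of length n.
  Holds : Formula L (k ℕ.* n) → Vec X k → Set ℓ
  Holds φ xs = M ⊨ φ [ concat (Vec.map ι xs) ]

  field
    d<1-definable : ∃[ δ ] (∀ x y → Holds {k = 2} δ (x ∷ y ∷ []) ⇔ d x y < 1ℝ)

module _ {L : Language ℓ} {𝕏 : MetricSpace ℓ} (D : DefiningStructure L 𝕏) where
  open MetricSpace 𝕏 renaming (Carrier to X)
  open DefiningStructure D
  open VecMembership setoid using (_∈_)

  -- For φ(x, y) with |x| = n and |y| = m * n, the set φ(X, b̄).
  slice : ∀ m → Formula L (ℕ.suc m ℕ.* n) → Vec X m → Pred X ℓ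
  slice m φ b̄ x = Holds {k = ℕ.suc m} φ (x ∷ b̄)

  ThicknessDefinable : Set ℓ
  ThicknessDefinable = ∀ m (φ : Formula L (ℕ.suc m ℕ.* n)) →
    Σ[ ψ ∈ Formula L (m ℕ.* n) ] (∀ b̄ → Holds {k = m} ψ b̄ ⇔ Thick 𝕏 (slice m φ b̄))

  Independent : Pred X ℓ → Set ℓ
  Independent Y = ∀ m (φ : Formula L (ℕ.suc m ℕ.* n)) (b̄ : Vec X m) →
    VecAll.All Y b̄ → Thin 𝕏 (slice m φ b̄) → ∀ y → Y y → slice m φ b̄ y → y ∈ b̄

  Lind : Language ℓ
  Lind = record { Func = λ _ → ⊥ ; Rel′ = λ k → Formula L (k ℕ.* n) }

  vertexInd : (V : Pred X ℓ) → Structure Lind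
  vertexInd V = record
    { domain   = subsetoid setoid V
    ; ⟦_⟧ᶠ     = λ ()
    ; ⟦_⟧ʳ     = λ {k} φ as → Holds {k = k} φ (Vec.map proj₁ as)
    ; fun-cong = λ ()
    ; rel-resp = λ {k} φ p → Equivalence.to
        (⊨-cong M (Pointwise.concat⁺ (Pointwise.map⁺ ι-cong (Pointwise.map⁺ id p))) φ)
    }

  graphInd : {V : Pred X ℓ} → Graph (subsetoid setoid V) → Structure (Lind ∪E)
  graphInd {V} G = expand (vertexInd V) G

-- Finite sets of vertices are given by lists; membership and
-- disjointness are up to the equality of the vertex setoid.
record GEC (𝕏 : MetricSpace ℓ) {S : Pred (MetricSpace.Carrier 𝕏) ℓ}
           (G : Graph (subsetoid (MetricSpace.setoid 𝕏) S)) : Set ℓ where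
  open MetricSpace 𝕏 using (d; setoid)
  open Graph G using (Adj)
  open ListMembership (subsetoid setoid S) using (_∉_)
  open ListDisjoint (subsetoid setoid S) using (Disjoint)
  field
    dense   : Dense 𝕏 S
    local   : ∀ u v → Adj u v → d (proj₁ u) (proj₁ v) < 1ℝ
    extends : ∀ (s : ∃ S) (A B : List (∃ S)) → Disjoint A B →
              ListAll.All (λ a → Ball 𝕏 (proj₁ s) 1ℝ (proj₁ a)) A →
              ListAll.All (λ b → Ball 𝕏 (proj₁ s) 1ℝ (proj₁ b)) B →
              ∀ ε → 0ℝ < ε →
              ∃[ v ] v ∉ A × v ∉ B × d (proj₁ s) (proj₁ v) < ε ×
                     ListAll.All (Adj v) A × ListAll.All (λ b → ¬ Adj v b) B

{-# OPTIONS --safe #-}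

-- Over an independent dense set V, a set χ(X, ȳ) meets V outside ȳ only if it
-- is thick, and every thick set meets V.  Since thickness is definable, the
-- quantifier in ∀x χ(x, ȳ) over V can be replaced by an 𝓛-formula in ȳ.
-- For a g.e.c. graph, an 𝓛ᴱ-formula is an 𝓛-formula once the adjacency matrix
-- of its variables is fixed, and a point x with prescribed adjacencies σ to ȳ
-- exists in χ(X, ȳ) outside ȳ iff σ respects the equalities within ȳ and
-- χ(x, ȳ) ∧ ⋀ { d(x, yᵢ) < 1 : σᵢ } is thick.  The resulting 𝓛-formulas do not
-- depend on V or on the graph, whence elementary equivalence.

module Submission where

open import Defs
open import Axiom.ExcludedMiddle using (ExcludedMiddle)
open import Data.Bool.Base using (Bool; true; false; T)
open import Data.Fin.Base using (Fin; zero; suc; combine; remQuot; lift)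
open import Data.Fin.Properties using (combine-remQuot)
open import Data.List.Base as List using (List; []; _∷_; allFin; cartesianProductWith)
import Data.List.Membership.Propositional as List
open import Data.List.Membership.Propositional.Properties
  using (∈-allFin; ∈-map⁺; ∈-filter⁺; ∈-filter⁻; ∈-cartesianProductWith⁺)
open import Data.List.Relation.Unary.All using (All)
import Data.List.Relation.Unary.All as All
import Data.List.Relation.Unary.All.Properties as All
open import Data.List.Relation.Unary.Any using (Any; here; there)
import Data.List.Relation.Unary.Any.Properties as Any
import Data.List.Membership.Setoid as ListMembership
open import Data.Nat.Base as ℕ using (ℕ)
import Data.Nat.Properties as ℕ
open import Data.Product.Base using (∃; ∃-syntax; _×_; _,_; proj₁; proj₂; uncurry; map₁)
open import Data.Rational.Base as ℚ using (ℚ; 0ℚ; ½)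
import Data.Rational.Properties as ℚ
open import Data.Sum.Base using (_⊎_; inj₁; inj₂)
open import Data.Vec.Base as Vec using (Vec; []; _∷_; concat; lookup; tabulate)
open import Data.Vec.Properties
  using (lookup-concat; lookup-map; lookup∘tabulate; tabulate∘lookup)
import Data.Vec.Relation.Binary.Pointwise.Extensional as Extensional
import Data.Vec.Relation.Unary.All as VecAll
import Data.Vec.Relation.Unary.All.Properties as VecAll
import Data.Vec.Relation.Unary.Any as VecAny
import Data.Vec.Relation.Unary.Any.Properties as VecAny
open import Data.Vec.Relation.Binary.Pointwise.Inductive as Pointwise
  using (Pointwise; []; _∷_)
open import Function.Base using (_∘_)
open import Function.Bundles using (_⇔_; mk⇔; Equivalence)
open import Function.Metric.Structures using (module IsGeneralMetric)
open import Level using (Level; lower)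
open import Relation.Binary.Bundles using (Setoid)
open import Relation.Binary.PropositionalEquality as ≡ using (_≡_; refl)
open import Relation.Nullary.Decidable.Core using (Dec; T?; yes; no; does; decidable-stable)
open import Relation.Nullary.Negation using (¬_; contradiction)
open import Relation.Unary using (Pred; Decidable)

open Equivalence using (to; from)

private
  variable
    ℓ : Level
    j k : ℕ

-- Strict inequalities between Cauchy reals.

0<½* : ∀ {ε} → 0ℚ ℚ.< ε → 0ℚ ℚ.< ½ ℚ.* ε
0<½* {ε} 0<ε = ≡.subst (ℚ._< ½ ℚ.* ε) (ℚ.*-zeroʳ ½) (ℚ.*-monoʳ-<-pos ½ 0<ε)

½*+½* : ∀ ε → ½ ℚ.* ε ℚ.+ ½ ℚ.* ε ≡ ε
½*+½* ε = ≡.trans (≡.sym (ℚ.*-distribʳ-+ ε ½ ½)) (ℚ.*-identityˡ ε)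

≤-<-trans : ∀ {x y z} → x ≤ y → y < z → x < z
≤-<-trans {x} {y} {z} x≤y (ε , 0<ε , M , p) =
  -- Half of the gap `ε` of `y < z` absorbs the error allowed in `x ≤ y`; the other half is the gap
  -- left between `x` and `z`.
  let N , q = x≤y (½ ℚ.* ε) (0<½* 0<ε)
  in ½ ℚ.* ε , 0<½* 0<ε , M ℕ.⊔ N , λ i i≥ → begin
    seq x i ℚ.+ ½ ℚ.* ε
      ≤⟨ ℚ.+-monoˡ-≤ (½ ℚ.* ε) (q i (ℕ.m⊔n≤o⇒n≤o M N i≥)) ⟩
    seq y i ℚ.+ ½ ℚ.* ε ℚ.+ ½ ℚ.* ε
      ≡⟨ ℚ.+-assoc (seq y i) (½ ℚ.* ε) (½ ℚ.* ε) ⟩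
    seq y i ℚ.+ (½ ℚ.* ε ℚ.+ ½ ℚ.* ε)
      ≡⟨ ≡.cong (seq y i ℚ.+_) (½*+½* ε) ⟩
    seq y i ℚ.+ ε
      ≤⟨ p i (ℕ.m⊔n≤o⇒m≤o M N i≥) ⟩
    seq z i ∎
  where open ℚ.≤-Reasoning

-- The rational witness of `x < z` serves as the gap itself. Keeping it rational lets `balls-∩-open`
-- take a minimum of radii in ℚ.
<⇒gap : ∀ {x z} → x < z →
        ∃[ ε ] 0ℚ ℚ.< ε × (∀ y → y < fromℚ ε → x + y < z)
<⇒gap {x} {z} (ε , 0<ε , M , p) = ε , 0<ε , λ y (η , 0<η , N , q) →
  η , 0<η , M ℕ.⊔ N , λ i i≥ → begin
    seq x i ℚ.+ seq y i ℚ.+ η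
      ≡⟨ ℚ.+-assoc (seq x i) (seq y i) η ⟩
    seq x i ℚ.+ (seq y i ℚ.+ η)
      ≤⟨ ℚ.+-monoʳ-≤ (seq x i) (q i (ℕ.m⊔n≤o⇒n≤o M N i≥)) ⟩
    seq x i ℚ.+ ε
      ≤⟨ p i (ℕ.m⊔n≤o⇒m≤o M N i≥) ⟩
    seq z i ∎
  where open ℚ.≤-Reasoning

<fromℚ-≤-trans : ∀ {x p q} → x < fromℚ p → p ℚ.≤ q → x < fromℚ q
<fromℚ-≤-trans (ε , 0<ε , N , h) p≤q = ε , 0<ε , N , λ i i≥ → ℚ.≤-trans (h i i≥) p≤q

fromℚ-pos : ∀ {q} → 0ℚ ℚ.< q → 0ℝ < fromℚ q
fromℚ-pos {q} 0<q = q , 0<q , 0 , λ _ _ → ℚ.≤-reflexive (ℚ.+-identityˡ q)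

-- Open balls and thick sets.

module _ (𝕏 : MetricSpace ℓ) where
  open MetricSpace 𝕏
  private module Metric = IsGeneralMetric isMetric

  d-sym-< : ∀ {x y r} → d x y < r → d y x < r
  d-sym-< {x} {y} {r} =
    ≤-<-trans {d y x} {d x y} {r} (proj₁ (Metric.sym y x))

  ball-open : ∀ {c x r} → Ball 𝕏 c r x →
              ∃[ ε ] 0ℚ ℚ.< ε × (∀ y → Ball 𝕏 x (fromℚ ε) y → Ball 𝕏 c r y)
  ball-open {c} {x} {r} x∈B =
    let ε , 0<ε , gap = <⇒gap {d c x} {r} x∈B
    in ε , 0<ε , λ y y∈B → ≤-<-trans {d c y} {d c x + d x y} {r}
      (Metric.triangle c x y) (gap (d x y) y∈B)

  balls-∩-open : ∀ {c c′ x r r′} → Ball 𝕏 c r x → Ball 𝕏 c′ r′ x →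
                 ∃[ ε ] 0ℝ < ε × (∀ y → Ball 𝕏 x ε y → Ball 𝕏 c r y × Ball 𝕏 c′ r′ y)
  balls-∩-open {r = r} {r′} x∈B x∈B′ =
    let ε  , 0<ε  , B⊆  = ball-open {r = r} x∈B
        ε′ , 0<ε′ , B⊆′ = ball-open {r = r′} x∈B′
    in fromℚ (ε ℚ.⊓ ε′)
     , fromℚ-pos (⊓-pos (ℚ.⊓-sel ε ε′) 0<ε 0<ε′)
     , λ y y∈B → B⊆  y (<fromℚ-≤-trans {d _ y} y∈B (ℚ.p⊓q≤p ε ε′))
               , B⊆′ y (<fromℚ-≤-trans {d _ y} y∈B (ℚ.p⊓q≤q ε ε′))
    where
    ⊓-pos : ∀ {p q r} → r ≡ p ⊎ r ≡ q → 0ℚ ℚ.< p → 0ℚ ℚ.< q → 0ℚ ℚ.< r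
    ⊓-pos (inj₁ refl) 0<p _   = 0<p
    ⊓-pos (inj₂ refl) _   0<q = 0<q

Thick-map : {𝕏 : MetricSpace ℓ} {A B : Pred (MetricSpace.Carrier 𝕏) ℓ} →
            (∀ x → A x → B x) → Thick 𝕏 A → Thick 𝕏 B
Thick-map A⊆B (c , r , 0<r , B⊆A) = c , r , 0<r , λ x x∈ → A⊆B x (B⊆A x x∈)

-- Formulas: derived connectives, renaming of variables, satisfaction.

module _ {L : Language ℓ} where

  infixr 7 _∧′_

  ⊤′ : Formula L k
  ⊤′ = ⊥′ ⇒ ⊥′

  ¬′_ : Formula L k → Formula L k
  ¬′ φ = φ ⇒ ⊥′

  _∧′_ : Formula L k → Formula L k → Formula L k
  φ ∧′ ψ = ¬′ (φ ⇒ ¬′ ψ)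

  ⋀ : ∀ {a} {A : Set a} → List A → (A → Formula L k) → Formula L k
  ⋀ []       f = ⊤′
  ⋀ (a ∷ as) f = f a ∧′ ⋀ as f

  bit : Bool → Formula L k
  bit true  = ⊤′
  bit false = ⊥′

  ∀* : Formula L k → Sentence L
  ∀* {ℕ.zero}  φ = φ
  ∀* {ℕ.suc k} φ = ∀* (∀′ φ)

  bit-QF : ∀ b → QuantifierFree L {k} (bit b)
  bit-QF true  = ⊥′ ⇒ ⊥′
  bit-QF false = ⊥′

  ∧′-QF : {φ ψ : Formula L k} → QuantifierFree L φ → QuantifierFree L ψ →
          QuantifierFree L (φ ∧′ ψ)
  ∧′-QF p q = (p ⇒ (q ⇒ ⊥′)) ⇒ ⊥′

  ⋀-QF : ∀ {a} {A : Set a} (as : List A) {f : A → Formula L k} →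
         (∀ a → QuantifierFree L (f a)) → QuantifierFree L (⋀ as f)
  ⋀-QF []       p = ⊥′ ⇒ ⊥′
  ⋀-QF (a ∷ as) p = ∧′-QF (p a) (⋀-QF as p)

  mutual
    renameTerm : (Fin j → Fin k) → Term L j → Term L k
    renameTerm ρ (var i)    = var (ρ i)
    renameTerm ρ (fun f ts) = fun f (renameTerms ρ ts)

    renameTerms : ∀ {m} → (Fin j → Fin k) → Vec (Term L j) m → Vec (Term L k) m
    renameTerms ρ []       = []
    renameTerms ρ (t ∷ ts) = renameTerm ρ t ∷ renameTerms ρ ts

  rename : (Fin j → Fin k) → Formula L j → Formula L k
  rename ρ ⊥′         = ⊥′
  rename ρ (s ≐ t)    = renameTerm ρ s ≐ renameTerm ρ t
  rename ρ (rel R ts) = rel R (renameTerms ρ ts)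
  rename ρ (φ ⇒ ψ)    = rename ρ φ ⇒ rename ρ ψ
  rename ρ (∀′ φ)     = ∀′ (rename (lift 1 ρ) φ)

  module _ (N : Structure L) where
    open Structure N using (Carrier)

    ⊨-bit : ∀ b {v : Vec Carrier k} → N ⊨ bit b [ v ] ⇔ T b
    ⊨-bit true  = mk⇔ _ λ _ ()
    ⊨-bit false = mk⇔ (λ ()) λ ()

    ⊨-∀* : (φ : Formula L k) → N ⊨ ∀* φ [ [] ] ⇔ (∀ v → N ⊨ φ [ v ])
    ⊨-∀* {ℕ.zero}  φ = mk⇔ (λ { h [] → h }) λ h → h []
    ⊨-∀* {ℕ.suc k} φ = mk⇔
      (λ { h (a ∷ v) → to (⊨-∀* (∀′ φ)) h v a })
      (λ h → from (⊨-∀* (∀′ φ)) λ v a → h (a ∷ v))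

    mutual
      eval-rename : {ρ : Fin j → Fin k} {u : Vec Carrier j} {v : Vec Carrier k} →
                    (∀ i → lookup v (ρ i) ≡ lookup u i) →
                    ∀ t → eval N v (renameTerm ρ t) ≡ eval N u t
      eval-rename p (var i)    = p i
      eval-rename p (fun f ts) = ≡.cong (Structure.⟦_⟧ᶠ N f) (evals-rename p ts)

      evals-rename : ∀ {m} {ρ : Fin j → Fin k} {u : Vec Carrier j} {v : Vec Carrier k} →
                     (∀ i → lookup v (ρ i) ≡ lookup u i) →
                     (ts : Vec (Term L j) m) → evals N v (renameTerms ρ ts) ≡ evals N u ts
      evals-rename p []       = refl
      evals-rename p (t ∷ ts) = ≡.cong₂ _∷_ (eval-rename p t) (evals-rename p ts)

    ⊨-rename : {ρ : Fin j → Fin k} {u : Vec Carrier j} {v : Vec Carrier k} →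
               (∀ i → lookup v (ρ i) ≡ lookup u i) →
               ∀ φ → N ⊨ rename ρ φ [ v ] ⇔ N ⊨ φ [ u ]
    ⊨-rename p ⊥′ = mk⇔ (λ ()) λ ()
    ⊨-rename {u = u} {v} p (s ≐ t)
      rewrite eval-rename {u = u} {v} p s | eval-rename {u = u} {v} p t = mk⇔ (λ h → h) λ h → h
    ⊨-rename {u = u} {v} p (rel R ts)
      rewrite evals-rename {u = u} {v} p ts = mk⇔ (λ h → h) λ h → h
    ⊨-rename p (φ ⇒ ψ) = mk⇔
      (λ h → to   (⊨-rename p ψ) ∘ h ∘ from (⊨-rename p φ))
      (λ h → from (⊨-rename p ψ) ∘ h ∘ to   (⊨-rename p φ))
    ⊨-rename {ρ = ρ} {u} {v} p (∀′ φ) = mk⇔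
      (λ h a → to   (⊨-rename (lifted a) φ) (h a))
      (λ h a → from (⊨-rename (lifted a) φ) (h a))
      where
      lifted : ∀ a i → lookup (a ∷ v) (lift 1 ρ i) ≡ lookup (a ∷ u) i
      lifted a zero    = refl
      lifted a (suc i) = p i

    module _ (em : ExcludedMiddle ℓ) where

      ⊨-∧ : (φ ψ : Formula L k) {v : Vec Carrier k} →
            N ⊨ φ ∧′ ψ [ v ] ⇔ (N ⊨ φ [ v ] × N ⊨ ψ [ v ])
      ⊨-∧ φ ψ = mk⇔
        (λ h → decidable-stable em (λ ¬φ → lower (h λ p → contradiction p ¬φ))
             , decidable-stable em (λ ¬ψ → lower (h λ _ q → contradiction q ¬ψ)))
        (λ (p , q) h → h p q)

      ⊨-⋀ : ∀ {a} {A : Set a} (as : List A) (f : A → Formula L k) {v : Vec Carrier k} →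
            N ⊨ ⋀ as f [ v ] ⇔ (∀ a → a List.∈ as → N ⊨ f a [ v ])
      ⊨-⋀ []       f = mk⇔ (λ _ _ ()) λ _ ()
      ⊨-⋀ (a ∷ as) f = mk⇔
        (λ { h _ (here refl) → proj₁ (to (⊨-∧ (f a) (⋀ as f)) h)
           ; h b (there b∈)  → to (⊨-⋀ as f) (proj₂ (to (⊨-∧ (f a) (⋀ as f)) h)) b b∈ })
        (λ h → from (⊨-∧ (f a) (⋀ as f))
          (h a (here refl) , from (⊨-⋀ as f) λ b b∈ → h b (there b∈)))

  -- As `ψ` does not depend on `v`, the universal closures of `φ ⇒ ψ` and `ψ ⇒ φ` are sentences of
  -- `Th N`, hence true in each of its models. Equivalence over the single structure `N` is
  -- therefore enough.
  structureHasQE : (N : Structure L) →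
    (∀ k (φ : Formula L k) →
      ∃[ ψ ] QuantifierFree L ψ × (∀ v → N ⊨ φ [ v ] ⇔ N ⊨ ψ [ v ])) →
    StructureHasQE N
  structureHasQE N elim k φ =
    let ψ , qf , φ⇔ψ = elim k φ
    in ψ , qf , λ N′ ⊨Th v → mk⇔
      (to (⊨-∀* N′ (φ ⇒ ψ)) (⊨Th (∀* (φ ⇒ ψ)) (from (⊨-∀* N (φ ⇒ ψ)) (to ∘ φ⇔ψ))) v)
      (to (⊨-∀* N′ (ψ ⇒ φ)) (⊨Th (∀* (ψ ⇒ φ)) (from (⊨-∀* N (ψ ⇒ φ)) (from ∘ φ⇔ψ))) v)

-- Finite selections and Boolean patterns.

module _ {a p} {A : Set a} {P : Pred (Fin k) p} (P? : Decidable P) (f : Fin k → A) where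

  select : List A
  select = List.map f (List.filter P? (allFin k))

  select-All⁺ : ∀ {q} {Q : Pred A q} → (∀ i → P i → Q (f i)) → All Q select
  select-All⁺ h = All.map⁺ (All.map (h _) (All.all-filter P? (allFin k)))

  select-All⁻ : ∀ {q} {Q : Pred A q} → All Q select → ∀ i → P i → Q (f i)
  select-All⁻ h i pᵢ = All.lookup h (∈-map⁺ f (∈-filter⁺ P? (∈-allFin i) pᵢ))

  select-Any⁻ : ∀ {q} {Q : Pred A q} → Any Q select → ∃[ i ] P i × Q (f i)
  select-Any⁻ h =
    let i , i∈ , q = ListMembership.find (≡.setoid _) (Any.map⁻ h)
    in i , proj₂ (∈-filter⁻ P? {xs = allFin k} i∈) , q

vecs : ∀ {a} {A : Set a} → List A → ∀ k → List (Vec A k)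
vecs as ℕ.zero    = [] ∷ []
vecs as (ℕ.suc k) = cartesianProductWith _∷_ as (vecs as k)

∈-vecs : ∀ {a} {A : Set a} {as : List A} → (∀ a → a List.∈ as) →
         (v : Vec A k) → v List.∈ vecs as k
∈-vecs complete []      = here refl
∈-vecs complete (a ∷ v) = ∈-cartesianProductWith⁺ _∷_ (complete a) (∈-vecs complete v)

boolVecs : ∀ k → List (Vec Bool k)
boolVecs = vecs (true ∷ false ∷ [])

∈-boolVecs : (v : Vec Bool k) → v List.∈ boolVecs k
∈-boolVecs = ∈-vecs λ { true → here refl ; false → there (here refl) }

module _ (em : ExcludedMiddle ℓ) where

  -- Excluded middle turns any pattern of truth values into a Boolean vector. There are finitely
  -- many of these, so a formula can range over all adjacency patterns by a finite conjunction.
  reflect : (P : Fin k → Set ℓ) → ∃[ σ ] (∀ i → T (lookup {n = k} σ i) ⇔ P i)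
  reflect P = tabulate (λ i → does (em {P i})) , λ i →
    ≡.subst (λ b → T b ⇔ P i) (≡.sym (lookup∘tabulate _ i)) (T-does em)
    where
    T-does : ∀ {A : Set _} (a? : Dec A) → T (does a?) ⇔ A
    T-does (yes a) = mk⇔ (λ _ → a) _
    T-does (no ¬a) = mk⇔ (λ ()) ¬a

-- Realising adjacency patterns in g.e.c. graphs.

module _ (em : ExcludedMiddle ℓ) (𝕏 : MetricSpace ℓ) where
  open MetricSpace 𝕏

  -- Induction on the number of points: if the current ball meets the unit ball around `y zero`,
  -- some smaller ball lies inside both; otherwise it misses that unit ball already. Further
  -- shrinking preserves either alternative.
  separate : (y : Fin k → Carrier) → ∀ c r → 0ℝ < r →
             ∃[ c′ ] ∃[ r′ ] 0ℝ < r′ × (∀ x → Ball 𝕏 c′ r′ x → Ball 𝕏 c r x) ×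
               (∀ i → (∀ x → Ball 𝕏 c′ r′ x → Ball 𝕏 (y i) 1ℝ x) ⊎
                      (∀ x → Ball 𝕏 c′ r′ x → ¬ Ball 𝕏 (y i) 1ℝ x))
  separate {ℕ.zero}  y c r 0<r = c , r , 0<r , (λ _ x∈ → x∈) , λ ()
  separate {ℕ.suc k} y c r 0<r with em {∃[ x ] Ball 𝕏 c r x × Ball 𝕏 (y zero) 1ℝ x}
  ... | yes (x , x∈B , x∈B₀) =
    let ε , 0<ε , B⊆ = balls-∩-open 𝕏 {r = r} {1ℝ} x∈B x∈B₀
        c′ , r′ , 0<r′ , B′⊆ , sep = separate (y ∘ suc) x ε 0<ε
    in c′ , r′ , 0<r′ , (λ z z∈ → proj₁ (B⊆ z (B′⊆ z z∈))) , λ where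
         zero    → inj₁ λ z z∈ → proj₂ (B⊆ z (B′⊆ z z∈))
         (suc i) → sep i
  ... | no B∩B₀=∅ =
    let c′ , r′ , 0<r′ , B′⊆ , sep = separate (y ∘ suc) c r 0<r
    in c′ , r′ , 0<r′ , B′⊆ , λ where
         zero    → inj₂ λ z z∈ z∈B₀ → B∩B₀=∅ (z , B′⊆ z z∈ , z∈B₀)
         (suc i) → sep i

  module _ {V : Pred Carrier ℓ} (G : Graph (subsetoid setoid V)) (gec : GEC 𝕏 G) where
    open Graph G
    open GEC gec

    -- The ball is first shrunk until each unit ball around a vertex y i
    -- contains it or misses it; locality forbids edges in the latter case,
    -- so only the former vertices enter the extension axiom.
    thick⇒extension :
      (σ : Fin k → Bool) (y : Fin k → ∃ V) →
      (∀ i j → proj₁ (y i) ≈ proj₁ (y j) → T (σ i) → T (σ j)) →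
      {A : Pred Carrier ℓ} →
      Thick 𝕏 (λ x → A x × (∀ i → T (σ i) → Ball 𝕏 (proj₁ (y i)) 1ℝ x)) →
      ∃[ x ] A (proj₁ x) × (∀ i → T (σ i) ⇔ Adj x (y i))
    thick⇒extension σ y consistent (c , r , 0<r , B⊆) with separate (proj₁ ∘ y) c r 0<r
    ... | c′ , r′ , 0<r′ , B′⊆ , sep =
      -- The extension axiom is applied at a vertex `s` of the shrunken ball; asking for `v` within
      -- `ε` of `s` keeps `v` in that ball.
      let s , s∈V , s∈B′ = dense c′ r′ 0<r′
          ε , 0<ε , Bε⊆  = ball-open 𝕏 {r = r′} s∈B′
          v , _ , _ , v∈Bε , adj , ¬adj = extends (s , s∈V)
            (select (T? ∘ σ) y) (select avoid? y)
            -- The two lists are disjoint up to `_≈_` because `σ` agrees on equal vertices.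
            (λ (x∈ , x∈′) →
              let i , σᵢ , x≈yᵢ        = select-Any⁻ (T? ∘ σ) y x∈
                  j , (¬σⱼ , _) , x≈yⱼ = select-Any⁻ avoid? y x∈′
              in ¬σⱼ (consistent i j (S.trans (S.sym x≈yᵢ) x≈yⱼ) σᵢ))
            (select-All⁺ (T? ∘ σ) y λ i σᵢ →
              d-sym-< 𝕏 {r = 1ℝ} (proj₂ (B⊆ s (B′⊆ s s∈B′)) i σᵢ))
            (select-All⁺ avoid? y λ i (_ , near) → d-sym-< 𝕏 {r = 1ℝ} (near s s∈B′))
            (fromℚ ε) (fromℚ-pos 0<ε)
          v∈B′ = Bε⊆ (proj₁ v) v∈Bε
      in v , proj₁ (B⊆ (proj₁ v) (B′⊆ (proj₁ v) v∈B′)) , λ i → mk⇔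
        (select-All⁻ (T? ∘ σ) y adj i)
        (λ v~yᵢ → decidable-stable (T? (σ i)) λ ¬σᵢ →
          select-All⁻ avoid? y ¬adj i (¬σᵢ , adj⇒near i v v∈B′ v~yᵢ) v~yᵢ)
      where
      module S = Setoid setoid

      Near : Pred (Fin _) ℓ
      Near i = ∀ x → Ball 𝕏 c′ r′ x → Ball 𝕏 (proj₁ (y i)) 1ℝ x

      avoid? : Decidable (λ i → ¬ T (σ i) × Near i)
      avoid? _ = em

      adj⇒near : ∀ i v → Ball 𝕏 c′ r′ (proj₁ v) → Adj v (y i) → Near i
      adj⇒near i v v∈B′ v~yᵢ with sep i
      ... | inj₁ near = near
      ... | inj₂ far  =
        contradiction (d-sym-< 𝕏 {r = 1ℝ} (local v (y i) v~yᵢ)) (far (proj₁ v) v∈B′)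

-- Relational languages.

-- Terms of a language without function symbols are variables.
module _ {L : Language ℓ} (relational : ∀ {j} → ¬ Func L j) where

  index : Term L k → Fin k
  index (var i)   = i
  index (fun f _) = contradiction f relational

  module _ (N : Structure L) (v : Vec (Structure.Carrier N) k) where

    eval-index : ∀ t → eval N v t ≡ lookup v (index t)
    eval-index (var i)   = refl
    eval-index (fun f _) = contradiction f relational

    evals-index : (ts : Vec (Term L k) j) → ∀ i →
                  lookup v (index (lookup ts i)) ≡ lookup (evals N v ts) i
    evals-index (t ∷ ts) zero    = ≡.sym (eval-index t)
    evals-index (t ∷ ts) (suc i) = evals-index ts i

vars : {L : Language ℓ} → Vec (Term L k) k
vars = tabulate var

evals-vars : {L : Language ℓ} (N : Structure L) (v : Vec (Structure.Carrier N) k) →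
             evals N v vars ≡ v
evals-vars N v = ≡.trans (evals-tabulate var) (tabulate∘lookup v)
  where
  evals-tabulate : ∀ {j} (t : Fin j → Term _ _) →
                   evals N v (tabulate t) ≡ tabulate (eval N v ∘ t)
  evals-tabulate {ℕ.zero}  t = refl
  evals-tabulate {ℕ.suc j} t = ≡.cong (eval N v (t zero) ∷_) (evals-tabulate (t ∘ suc))

-- Formulas of 𝓛 in variables of the sort of X.

module _ (em : ExcludedMiddle ℓ) {𝕏 : MetricSpace ℓ} {L : Language ℓ}
         (D : DefiningStructure L 𝕏) where
  open MetricSpace 𝕏 renaming (Carrier to X)
  open DefiningStructure D
  private module S = Setoid setoid

  -- A variable in the sort of X is a block of `n` variables of 𝓛, so `f` has to move whole blocks
  -- and fix the position within each.
  block : (Fin j → Fin k) → Fin (j ℕ.* n) → Fin (k ℕ.* n)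
  block f = uncurry combine ∘ map₁ f ∘ remQuot n

  private
    coordinate : (v : Vec X k) → ∀ i b →
                 lookup (concat (Vec.map ι v)) (combine i b) ≡ lookup (ι (lookup v i)) b
    coordinate v i b = ≡.trans (lookup-concat (Vec.map ι v) i b)
                               (≡.cong (λ xs → lookup xs b) (lookup-map i ι v))

  Holds-rename : (f : Fin j → Fin k) (u : Vec X j) (v : Vec X k) →
                 (∀ i → lookup v (f i) ≡ lookup u i) →
                 ∀ χ → Holds (rename (block f) χ) v ⇔ Holds χ u
  Holds-rename {j = j} f u v p = ⊨-rename M λ b →
    let i , c = remQuot {j} n b in begin
    lookup (concat (Vec.map ι v)) (combine (f i) c)
      ≡⟨ coordinate v (f i) c ⟩
    lookup (ι (lookup v (f i))) c
      ≡⟨ ≡.cong (λ x → lookup (ι x) c) (p i) ⟩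
    lookup (ι (lookup u i)) c
      ≡⟨ coordinate u i c ⟨
    lookup (concat (Vec.map ι u)) (combine i c)
      ≡⟨ ≡.cong (lookup (concat (Vec.map ι u))) (combine-remQuot {j} n b) ⟩
    lookup (concat (Vec.map ι u)) b ∎
    where open ≡.≡-Reasoning

  equal : Fin k → Fin k → Formula L (k ℕ.* n)
  equal i j = ⋀ (allFin n) λ b → var (combine i b) ≐ var (combine j b)

  -- `ι-cong` and `ι-injective` identify equality in X with equality in `M` of all `n` coordinates.
  Holds-equal : (v : Vec X k) → ∀ i j → Holds (equal i j) v ⇔ lookup v i ≈ lookup v j
  Holds-equal v i j = mk⇔
    (λ h → ι-injective (Extensional.extensional⇒inductive (Extensional.ext λ b →
      ≡.subst₂ _≈ᴹ_ (coordinate v i b) (coordinate v j b)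
        (to (⊨-⋀ M em (allFin n) _) h b (∈-allFin b)))))
    (λ e → from (⊨-⋀ M em (allFin n) _) λ b _ →
      ≡.subst₂ _≈ᴹ_ (≡.sym (coordinate v i b)) (≡.sym (coordinate v j b))
        (Pointwise.lookup (ι-cong e) b))
    where open Structure M using () renaming (_≈_ to _≈ᴹ_)

  -- Variable zero is x, and variable suc i is the parameter yᵢ.
  near : Fin k → Formula L (ℕ.suc k ℕ.* n)
  near i = rename (block (lookup (suc i ∷ zero ∷ []))) (proj₁ d<1-definable)

  Holds-near : (v : Vec X k) → ∀ i x → Holds (near i) (x ∷ v) ⇔ Ball 𝕏 (lookup v i) 1ℝ x
  Holds-near v i x = mk⇔
    (to (proj₂ d<1-definable _ x) ∘ to renaming⇔)
    (from renaming⇔ ∘ from (proj₂ d<1-definable _ x))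
    where
    renaming⇔ : Holds (near i) (x ∷ v) ⇔ Holds (proj₁ d<1-definable) (lookup v i ∷ x ∷ [])
    renaming⇔ = Holds-rename (lookup (suc i ∷ zero ∷ [])) (lookup v i ∷ x ∷ []) (x ∷ v)
      (λ { zero → refl ; (suc zero) → refl }) (proj₁ d<1-definable)

  -- Serves the case in which the quantified point coincides with a parameter, where independence
  -- gives no information.
  instantiate : Fin k → Formula L (ℕ.suc k ℕ.* n) → Formula L (k ℕ.* n)
  instantiate i = rename (block (lookup (i ∷ Vec.allFin _)))

  Holds-instantiate : (v : Vec X k) → ∀ i χ →
                      Holds (instantiate i χ) v ⇔ Holds χ (lookup v i ∷ v)
  Holds-instantiate v i = Holds-rename (lookup (i ∷ Vec.allFin _)) (lookup v i ∷ v) v λ where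
    zero    → refl
    (suc j) → ≡.cong (lookup v) (lookup∘tabulate (λ l → l) j)

  -- A relation symbol of `Lind` is itself an 𝓛-formula, so an atomic formula translates to that
  -- formula with its blocks renamed. `L′` is general in order to cover both `Lind D` and
  -- `Lind D ∪E`.
  atom : {L′ : Language ℓ} → (∀ {j} → ¬ Func L′ j) →
         Formula L (j ℕ.* n) → Vec (Term L′ k) j → Formula L (k ℕ.* n)
  atom relational χ ts = rename (block (index relational ∘ lookup ts)) χ

  Holds-atom : {L′ : Language ℓ} (relational : ∀ {j} → ¬ Func L′ j)
               (N : Structure L′) (f : Structure.Carrier N → X)
               (v : Vec (Structure.Carrier N) k) →
               (χ : Formula L (j ℕ.* n)) (ts : Vec (Term L′ k) j) →
               Holds (atom relational χ ts) (Vec.map f v) ⇔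
               Holds χ (Vec.map f (evals N v ts))
  Holds-atom relational N f v χ ts =
    Holds-rename (index relational ∘ lookup ts) (Vec.map f (evals N v ts)) (Vec.map f v)
      (λ i → begin
    lookup (Vec.map f v) (index relational (lookup ts i))
      ≡⟨ lookup-map _ f v ⟩
    f (lookup v (index relational (lookup ts i)))
      ≡⟨ ≡.cong f (evals-index relational N v ts i) ⟩
    f (lookup (evals N v ts) i)
      ≡⟨ lookup-map i f (evals N v ts) ⟨
    lookup (Vec.map f (evals N v ts)) i ∎) χ
    where open ≡.≡-Reasoning

  module _ (V : Pred X ℓ) where

    points : Vec (∃ V) k → Vec X k
    points = Vec.map proj₁

    Holds-points-equal : (v : Vec (∃ V) k) → ∀ i j →
                         Holds (equal i j) (points v) ⇔ proj₁ (lookup v i) ≈ proj₁ (lookup v j)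
    Holds-points-equal v i j =
      ≡.subst₂ (λ x y → Holds (equal i j) (points v) ⇔ x ≈ y)
        (lookup-map i proj₁ v) (lookup-map j proj₁ v) (Holds-equal (points v) i j)

    Holds-points-instantiate : (v : Vec (∃ V) k) → ∀ i χ →
      Holds (instantiate i χ) (points v) ⇔ Holds χ (points (lookup v i ∷ v))
    Holds-points-instantiate v i χ =
      ≡.subst (λ x → Holds (instantiate i χ) (points v) ⇔ Holds χ (x ∷ points v))
        (lookup-map i proj₁ v) (Holds-instantiate (points v) i χ)

    -- The membership supplied by independence carries a position in the tuple, which becomes the
    -- index `i`.
    independent⇒parameter : Independent D V → (v : Vec (∃ V) k) →
      ∀ χ (x : ∃ V) → Holds χ (points (x ∷ v)) → Thin 𝕏 (slice D k χ (points v)) →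
      ∃[ i ] proj₁ x ≈ proj₁ (lookup v i)
    independent⇒parameter {k = k} independent v χ (x , x∈V) h thin =
      let x∈v = independent k χ (points v)
                  (VecAll.map⁺ (VecAll.universal proj₂ v)) thin x x∈V h
          i = VecAny.index x∈v
      in i , S.trans (VecAny.lookup-index x∈v) (S.reflexive (lookup-map i proj₁ v))

  -- Eliminating quantifiers over an independent dense set.

  module _ (thickness : ThicknessDefinable D) where

    thick : ∀ k → Formula L (ℕ.suc k ℕ.* n) → Formula L (k ℕ.* n)
    thick k χ = proj₁ (thickness k χ)

    -- The clause for `∀′` is the dual of the criterion for an existential quantifier: the statement
    -- holds at each parameter, and its counterexamples form a thin set.
    vertexNF : Formula (Lind D) k → Formula L (k ℕ.* n)
    vertexNF ⊥′         = ⊥′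
    vertexNF (s ≐ t)    = equal (index (λ ()) s) (index (λ ()) t)
    vertexNF (rel χ ts) = atom (λ ()) χ ts
    vertexNF (φ ⇒ ψ)    = vertexNF φ ⇒ vertexNF ψ
    vertexNF {k} (∀′ φ) =
      (⋀ (allFin k) λ i → instantiate i (vertexNF φ)) ∧′ ¬′ thick k (¬′ vertexNF φ)

    module _ {V : Pred X ℓ} (independent : Independent D V) (dense : Dense 𝕏 V) where

      vertexNF-correct : (φ : Formula (Lind D) k) (v : Vec (∃ V) k) →
                         vertexInd D V ⊨ φ [ v ] ⇔ Holds (vertexNF φ) (points V v)
      vertexNF-correct ⊥′ v = mk⇔ (λ ()) λ ()
      vertexNF-correct (s ≐ t) v
        rewrite eval-index (λ ()) (vertexInd D V) v s
              | eval-index (λ ()) (vertexInd D V) v t =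
        mk⇔ (from equal⇔) (to equal⇔)
        where
        equal⇔ = Holds-points-equal V v (index (λ ()) s) (index (λ ()) t)
      vertexNF-correct (rel χ ts) v =
        let atom⇔ = Holds-atom (λ ()) (vertexInd D V) proj₁ v χ ts
        in mk⇔ (from atom⇔) (to atom⇔)
      vertexNF-correct (φ ⇒ ψ) v = mk⇔
        (λ h → to   (vertexNF-correct ψ v) ∘ h ∘ from (vertexNF-correct φ v))
        (λ h → from (vertexNF-correct ψ v) ∘ h ∘ to   (vertexNF-correct φ v))
      vertexNF-correct {k = k} (∀′ φ) v = mk⇔
        (λ h → from ∧⇔
          ( from ⋀⇔ (λ i _ → from (instantiate⇔ i) (to (IH (lookup v i)) (h (lookup v i))))
          -- By density, a ball of counterexamples would contain a vertex.
          , λ th → let c , r , 0<r , B⊆ = to thick⇔ th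
                       x , x∈V , x∈B    = dense c r 0<r
                   in B⊆ x x∈B (to (IH (x , x∈V)) (h (x , x∈V)))))
        (λ h x → from (IH x) (decidable-stable em λ ¬χ →
          -- A counterexample `x` lies in a thin slice, so it equals a parameter, where an instance
          -- holds. The equality is only up to `_≈_`, so `⊨-cong` carries the truth of `φ` across.
          let instances , ¬thick = to ∧⇔ h
              i , x≈vᵢ = independent⇒parameter V independent v (¬′ χ) x
                           (λ hχ → contradiction hχ ¬χ)
                           (λ th → lower (¬thick (from thick⇔ th)))
          in ¬χ (to (IH x) (to
               (⊨-cong (vertexInd D V) (S.sym x≈vᵢ ∷ Pointwise.refl S.refl) φ)
               (from (IH (lookup v i)) (to (instantiate⇔ i) (to ⋀⇔ instances i (∈-allFin i))))))))
        where
        χ = vertexNF φ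
        IH = λ x → vertexNF-correct φ (x ∷ v)
        ∧⇔ = ⊨-∧ M em (⋀ (allFin k) λ i → instantiate i χ) (¬′ thick k (¬′ χ))
        ⋀⇔ = ⊨-⋀ M em (allFin k) (λ i → instantiate i χ)
        instantiate⇔ = λ i → Holds-points-instantiate V v i χ
        thick⇔ = proj₂ (thickness k (¬′ χ)) (points V v)

    -- Eliminating quantifiers over a g.e.c. graph.

    -- The corner entry is `false` by irreflexivity; `σ` fills both the new row and the new column
    -- by symmetry.
    extend : (Fin k → Bool) → (Fin k → Fin k → Bool) → Fin (ℕ.suc k) → Fin (ℕ.suc k) → Bool
    extend σ α zero    zero    = false
    extend σ α zero    (suc j) = σ j
    extend σ α (suc i) zero    = σ i
    extend σ α (suc i) (suc j) = α i j

    -- Equal parameters have the same neighbours, so a pattern separating them is realised by no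
    -- vertex and must impose no condition. `graphNF` uses this formula as a guard.
    consistent : (Fin k → Bool) → Formula L (k ℕ.* n)
    consistent {k} σ = ⋀ (allFin k) λ i → ⋀ (allFin k) λ j →
      equal i j ⇒ bit (σ i) ⇒ bit (σ j)

    -- This is the constraint that locality puts on a point with pattern `σ`; a non-edge restricts
    -- no distance.
    nearAll : (Fin k → Bool) → Formula L (ℕ.suc k ℕ.* n)
    nearAll {k} σ = ⋀ (allFin k) λ i → bit (σ i) ⇒ near i

    Holds-consistent : (V : Pred X ℓ) (v : Vec (∃ V) k) (σ : Fin k → Bool) →
      Holds (consistent σ) (points V v) ⇔
      (∀ i j → proj₁ (lookup v i) ≈ proj₁ (lookup v j) → T (σ i) → T (σ j))
    Holds-consistent {k} V v σ = mk⇔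
      (λ h i j vᵢ≈vⱼ σᵢ → to (⊨-bit M (σ j))
        (to (⊨-⋀ M em (allFin k) _) (to (⊨-⋀ M em (allFin k) _) h i (∈-allFin i)) j (∈-allFin j)
          (from (Holds-points-equal V v i j) vᵢ≈vⱼ) (from (⊨-bit M (σ i)) σᵢ)))
      (λ h → from (⊨-⋀ M em (allFin k) _) λ i _ → from (⊨-⋀ M em (allFin k) _) λ j _ e b →
        from (⊨-bit M (σ j))
          (h i j (to (Holds-points-equal V v i j) e) (to (⊨-bit M (σ i)) b)))

    Holds-nearAll : (V : Pred X ℓ) (v : Vec (∃ V) k) (σ : Fin k → Bool) (x : X) →
      Holds (nearAll σ) (x ∷ points V v) ⇔
      (∀ i → T (σ i) → Ball 𝕏 (proj₁ (lookup v i)) 1ℝ x)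
    Holds-nearAll {k} V v σ x = mk⇔
      (λ h i σᵢ → to (near⇔ i)
        (to (⊨-⋀ M em (allFin k) _) h i (∈-allFin i) (from (⊨-bit M (σ i)) σᵢ)))
      (λ h → from (⊨-⋀ M em (allFin k) _) λ i _ b → from (near⇔ i) (h i (to (⊨-bit M (σ i)) b)))
      where
      near⇔ : ∀ i → Holds (near i) (x ∷ points V v) ⇔ Ball 𝕏 (proj₁ (lookup v i)) 1ℝ x
      near⇔ i = ≡.subst (λ y → Holds (near i) (x ∷ points V v) ⇔ Ball 𝕏 y 1ℝ x)
        (lookup-map i proj₁ v) (Holds-near (points V v) i x)

    -- α is the adjacency matrix of the parameters, and σ that of x with them.
    graphNF : Formula (Lind D ∪E) k → (Fin k → Fin k → Bool) → Formula L (k ℕ.* n)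
    graphNF ⊥′                     α = ⊥′
    graphNF (s ≐ t)                α = equal (index (λ ()) s) (index (λ ()) t)
    graphNF (rel (old χ) ts)       α = atom (λ ()) χ ts
    graphNF (rel E (s ∷ t ∷ []))   α = bit (α (index (λ ()) s) (index (λ ()) t))
    graphNF (φ ⇒ ψ)                α = graphNF φ α ⇒ graphNF ψ α
    graphNF {k} (∀′ φ)             α =
      -- If `x` equals parameter `i`, its adjacency row is row `i` of `α`.
      (⋀ (allFin k) λ i → instantiate i (graphNF φ (extend (α i) α))) ∧′
      -- Away from the parameters every pattern is tested: the counterexamples whose position
      -- permits `σ` must form a thin set.
      (⋀ (boolVecs k) λ σ → consistent (lookup σ) ⇒
        ¬′ thick k (¬′ graphNF φ (extend (lookup σ) α) ∧′ nearAll (lookup σ)))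

    edge : Fin k → Fin k → Formula (Lind D ∪E) k
    edge i j = rel E (var i ∷ var j ∷ [])

    isAdjacencyMatrixᶠ : (Fin k → Fin k → Bool) → Formula (Lind D ∪E) k
    isAdjacencyMatrixᶠ {k} α = ⋀ (allFin k) λ i → ⋀ (allFin k) λ j →
      (bit (α i j) ⇒ edge i j) ∧′ (edge i j ⇒ bit (α i j))

    entry : Vec (Vec Bool k) k → Fin k → Fin k → Bool
    entry α i = lookup (lookup α i)

    -- `graphNF` may contain quantifiers of 𝓛, but as a relation symbol of `Lind` it is atomic.
    -- Exactly one matrix describes a given tuple of vertices, so the implications for all others
    -- hold vacuously.
    graphQF : Formula (Lind D ∪E) k → Formula (Lind D ∪E) k
    graphQF {k} φ = ⋀ (vecs (boolVecs k) k) λ α →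
      isAdjacencyMatrixᶠ (entry α) ⇒ rel (old (graphNF φ (entry α))) vars

    graphQF-QF : (φ : Formula (Lind D ∪E) k) → QuantifierFree (Lind D ∪E) (graphQF φ)
    graphQF-QF {k} φ = ⋀-QF (vecs (boolVecs k) k) λ α →
      (⋀-QF (allFin k) λ i → ⋀-QF (allFin k) λ j →
        ∧′-QF (bit-QF (entry α i j) ⇒ rel E _) (rel E _ ⇒ bit-QF (entry α i j)))
      ⇒ rel (old (graphNF φ (entry α))) vars

    module _ {V : Pred X ℓ} (independent : Independent D V)
             (G : Graph (subsetoid setoid V)) (gec : GEC 𝕏 G) where
      open Graph G renaming (sym to Adj-sym)

      IsAdjacencyMatrix : Vec (∃ V) k → (Fin k → Fin k → Bool) → Set ℓ
      IsAdjacencyMatrix v α = ∀ i j → T (α i j) ⇔ Adj (lookup v i) (lookup v j)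

      isAdjacencyMatrix-extend : ∀ {σ α} {x : ∃ V} {v : Vec (∃ V) k} →
        (∀ i → T (σ i) ⇔ Adj x (lookup v i)) → IsAdjacencyMatrix v α →
        IsAdjacencyMatrix (x ∷ v) (extend σ α)
      isAdjacencyMatrix-extend row mat zero    zero    = mk⇔ (λ ()) (irrefl S.refl)
      isAdjacencyMatrix-extend row mat zero    (suc j) = row j
      isAdjacencyMatrix-extend row mat (suc i) zero    =
        mk⇔ (Adj-sym ∘ to (row i)) (from (row i) ∘ Adj-sym)
      isAdjacencyMatrix-extend row mat (suc i) (suc j) = mat i j

      -- Induction on `φ` with `α` varying, since each quantifier enlarges the matrix by a row and a
      -- column.
      graphNF-correct : (φ : Formula (Lind D ∪E) k) (v : Vec (∃ V) k) →
                        ∀ α → IsAdjacencyMatrix v α →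
                        graphInd D G ⊨ φ [ v ] ⇔ Holds (graphNF φ α) (points V v)
      graphNF-correct ⊥′ v α mat = mk⇔ (λ ()) λ ()
      graphNF-correct (s ≐ t) v α mat
        rewrite eval-index (λ ()) (graphInd D G) v s
              | eval-index (λ ()) (graphInd D G) v t =
        mk⇔ (from equal⇔) (to equal⇔)
        where
        equal⇔ = Holds-points-equal V v (index (λ ()) s) (index (λ ()) t)
      graphNF-correct (rel (old χ) ts) v α mat =
        let atom⇔ = Holds-atom (λ ()) (graphInd D G) proj₁ v χ ts
        in mk⇔ (from atom⇔) (to atom⇔)
      graphNF-correct (rel E (s ∷ t ∷ [])) v α mat
        rewrite eval-index (λ ()) (graphInd D G) v s
              | eval-index (λ ()) (graphInd D G) v t =
        let i₁ = index (λ ()) s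
            i₂ = index (λ ()) t
        in mk⇔ (from (⊨-bit M (α i₁ i₂)) ∘ from (mat i₁ i₂))
               (to (mat i₁ i₂) ∘ to (⊨-bit M (α i₁ i₂)))
      graphNF-correct (φ ⇒ ψ) v α mat = mk⇔
        (λ h → to   (graphNF-correct ψ v α mat) ∘ h ∘ from (graphNF-correct φ v α mat))
        (λ h → from (graphNF-correct ψ v α mat) ∘ h ∘ to   (graphNF-correct φ v α mat))
      graphNF-correct {k = k} (∀′ φ) v α mat = mk⇔
        (λ h → from ∧⇔
          ( from ⋀ⁱ⇔ (λ i _ → from (instantiate⇔ i) (to (IHⁱ i) (h (lookup v i))))
          , from ⋀ˢ⇔ (λ σ _ cons th →
              -- A thick set of candidates for a consistent `σ` contains a vertex with exactly that
              -- pattern, which would refute the universal statement.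
              let x , ¬χx , row = thick⇒extension em 𝕏 G gec (lookup σ) (lookup v)
                                    (to (Holds-consistent V v (lookup σ)) cons)
                                    (Thick-map {𝕏 = 𝕏} (to ∘ θ⇔ σ) (to (thick⇔ σ) th))
              in ¬χx (to (IH x σ row) (h x)))))
        (λ h x →
          let instances , ¬thick = to ∧⇔ h
              -- The pattern that `x` actually has selects the relevant conjunct of the normal form.
              σ , row = reflect em λ i → Adj x (lookup v i)
          in from (IH x σ row) (decidable-stable em λ ¬χx →
            -- By locality a counterexample `x` lies in the slice of `θ σ`. Its pattern is
            -- consistent because adjacency respects `_≈_`, so the slice is thin and `x` is a
            -- parameter, where an instance holds.
            let i , x≈vᵢ = independent⇒parameter V independent v (θ σ) x
                  (from (θ⇔ σ (proj₁ x))
                    ( (λ hχ → contradiction hχ ¬χx)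
                    , λ i σᵢ → d-sym-< 𝕏 {r = 1ℝ}
                        (GEC.local gec x (lookup v i) (to (row i) σᵢ))))
                  (λ th → lower (to ⋀ˢ⇔ ¬thick σ (∈-boolVecs σ)
                    (from (Holds-consistent V v (lookup σ)) λ i j vᵢ≈vⱼ →
                      from (row j) ∘ proj₁ resp vᵢ≈vⱼ ∘ to (row i))
                    (from (thick⇔ σ) th)))
            in ¬χx (to (IH x σ row) (to
                 (⊨-cong (graphInd D G) (S.sym x≈vᵢ ∷ Pointwise.refl S.refl) φ)
                 (from (IHⁱ i)
                   (to (instantiate⇔ i) (to ⋀ⁱ⇔ instances i (∈-allFin i))))))))
        where
        χⁱ : Fin k → Formula L (ℕ.suc k ℕ.* n)
        χⁱ i = graphNF φ (extend (α i) α)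

        χ θ : Vec Bool k → Formula L (ℕ.suc k ℕ.* n)
        χ σ = graphNF φ (extend (lookup σ) α)
        θ σ = ¬′ χ σ ∧′ nearAll (lookup σ)

        IHⁱ = λ i → graphNF-correct φ (lookup v i ∷ v) (extend (α i) α)
                      (isAdjacencyMatrix-extend (mat i) mat)
        IH = λ x σ row → graphNF-correct φ (x ∷ v) (extend (lookup σ) α)
                           (isAdjacencyMatrix-extend row mat)
        instantiate⇔ = λ i → Holds-points-instantiate V v i (χⁱ i)
        ⋀ⁱ⇔ = ⊨-⋀ M em (allFin k) (λ i → instantiate i (χⁱ i))
        ⋀ˢ⇔ = ⊨-⋀ M em (boolVecs k) (λ σ → consistent (lookup σ) ⇒ ¬′ thick k (θ σ))
        ∧⇔ = ⊨-∧ M em (⋀ (allFin k) λ i → instantiate i (χⁱ i))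
                      (⋀ (boolVecs k) λ σ → consistent (lookup σ) ⇒ ¬′ thick k (θ σ))
        thick⇔ = λ σ → proj₂ (thickness k (θ σ)) (points V v)

        θ⇔ : ∀ σ x → slice D k (θ σ) (points V v) x ⇔
             (slice D k (¬′ χ σ) (points V v) x ×
              (∀ i → T (lookup σ i) → Ball 𝕏 (proj₁ (lookup v i)) 1ℝ x))
        θ⇔ σ x = mk⇔
          (λ h → let ¬χx , close = to (⊨-∧ M em (¬′ χ σ) (nearAll (lookup σ))) h
                 in ¬χx , to (Holds-nearAll V v (lookup σ) x) close)
          (λ (¬χx , close) → from (⊨-∧ M em (¬′ χ σ) (nearAll (lookup σ)))
            (¬χx , from (Holds-nearAll V v (lookup σ) x) close))

      adjacencyMatrix : (v : Vec (∃ V) k) → ∃[ α ] IsAdjacencyMatrix v (entry α)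
      adjacencyMatrix v = tabulate (proj₁ ∘ row) , λ i j →
        ≡.subst (λ σ → T (lookup σ j) ⇔ Adj (lookup v i) (lookup v j))
          (≡.sym (lookup∘tabulate (proj₁ ∘ row) i)) (proj₂ (row i) j)
        where
        row = λ i → reflect em λ j → Adj (lookup v i) (lookup v j)

      ⊨-isAdjacencyMatrixᶠ : (v : Vec (∃ V) k) → ∀ α →
        graphInd D G ⊨ isAdjacencyMatrixᶠ α [ v ] ⇔ IsAdjacencyMatrix v α
      ⊨-isAdjacencyMatrixᶠ {k = k} v α = mk⇔
        (λ h i j → let bit⇒E , E⇒bit = to (∧⇔ i j)
                         (to (⊨-⋀ N em (allFin k) _)
                           (to (⊨-⋀ N em (allFin k) _) h i (∈-allFin i)) j (∈-allFin j))
                   in mk⇔ (bit⇒E ∘ from (⊨-bit N (α i j) {v})) (to (⊨-bit N (α i j) {v}) ∘ E⇒bit))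
        (λ mat → from (⊨-⋀ N em (allFin k) _) λ i _ → from (⊨-⋀ N em (allFin k) _) λ j _ →
          from (∧⇔ i j)
            ( to (mat i j) ∘ to (⊨-bit N (α i j) {v})
            , from (⊨-bit N (α i j) {v}) ∘ from (mat i j)))
        where
        N = graphInd D G
        ∧⇔ = λ i j → ⊨-∧ N em (bit (α i j) ⇒ edge i j) (edge i j ⇒ bit (α i j)) {v}

      graphQF-correct : (φ : Formula (Lind D ∪E) k) (v : Vec (∃ V) k) →
                        graphInd D G ⊨ φ [ v ] ⇔ graphInd D G ⊨ graphQF φ [ v ]
      graphQF-correct {k = k} φ v = mk⇔
        (λ h → from ⋀⇔ λ α _ matᶠ → ≡.subst (Holds (graphNF φ (entry α)) ∘ points V)
          (≡.sym (evals-vars N v))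
          (to (graphNF-correct φ v (entry α) (to (⊨-isAdjacencyMatrixᶠ v (entry α)) matᶠ)) h))
        (λ h → let α , mat = adjacencyMatrix v
               in from (graphNF-correct φ v (entry α) mat)
                    (≡.subst (Holds (graphNF φ (entry α)) ∘ points V) (evals-vars N v)
                      (to ⋀⇔ h α (∈-vecs ∈-boolVecs α)
                        (from (⊨-isAdjacencyMatrixᶠ v (entry α)) mat))))
        where
        N = graphInd D G
        ⋀⇔ = ⊨-⋀ N em (vecs (boolVecs k) k)
               (λ α → isAdjacencyMatrixᶠ (entry α) ⇒ rel (old (graphNF φ (entry α))) vars)

-- Passage to the language of graphs.

module _ {𝕏 : MetricSpace ℓ} {L : Language ℓ} (D : DefiningStructure L 𝕏) where
  open MetricSpace 𝕏 using (Carrier; setoid)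

  -- `E` has the same meaning in both structures, so elementary equivalence in `Lind D ∪E` passes to
  -- `Lᴳ` along this embedding.
  fromLᴳ : Formula (Lᴳ {ℓ}) k → Formula (Lind D ∪E) k
  fromLᴳ ⊥′                   = ⊥′
  fromLᴳ (s ≐ t)              = var (index (λ ()) s) ≐ var (index (λ ()) t)
  fromLᴳ (rel E (s ∷ t ∷ [])) = rel E (var (index (λ ()) s) ∷ var (index (λ ()) t) ∷ [])
  fromLᴳ (φ ⇒ ψ)              = fromLᴳ φ ⇒ fromLᴳ ψ
  fromLᴳ (∀′ φ)               = ∀′ (fromLᴳ φ)

  ⊨-fromLᴳ : {V : Pred Carrier ℓ} (G : Graph (subsetoid setoid V)) →
             (φ : Formula Lᴳ k) (v : Vec (∃ V) k) →
             graphStructure G ⊨ φ [ v ] ⇔ graphInd D G ⊨ fromLᴳ φ [ v ]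
  ⊨-fromLᴳ G ⊥′ v = mk⇔ (λ ()) λ ()
  ⊨-fromLᴳ G (s ≐ t) v
    rewrite eval-index (λ ()) (graphStructure G) v s
          | eval-index (λ ()) (graphStructure G) v t = mk⇔ (λ h → h) λ h → h
  ⊨-fromLᴳ G (rel E (s ∷ t ∷ [])) v
    rewrite eval-index (λ ()) (graphStructure G) v s
          | eval-index (λ ()) (graphStructure G) v t = mk⇔ (λ h → h) λ h → h
  ⊨-fromLᴳ G (φ ⇒ ψ) v = mk⇔
    (λ h → to   (⊨-fromLᴳ G ψ v) ∘ h ∘ from (⊨-fromLᴳ G φ v))
    (λ h → from (⊨-fromLᴳ G ψ v) ∘ h ∘ to   (⊨-fromLᴳ G φ v))
  ⊨-fromLᴳ G (∀′ φ) v = mk⇔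
    (λ h a → to   (⊨-fromLᴳ G φ (a ∷ v)) (h a))
    (λ h a → from (⊨-fromLᴳ G φ (a ∷ v)) (h a))

theorem3p3 : ∀ {ℓ} → ExcludedMiddle ℓ →
    (𝕏 : MetricSpace ℓ) → Separable 𝕏 → NoIsolatedPoints 𝕏 →
    (L : Language ℓ) (D : DefiningStructure L 𝕏) →
    (V₁ V₂ : Pred (MetricSpace.Carrier 𝕏) ℓ) →
    Independent D V₁ → Dense 𝕏 V₁ →
    Independent D V₂ → Dense 𝕏 V₂ →
    ThicknessDefinable D →
    (G₁ : Graph (subsetoid (MetricSpace.setoid 𝕏) V₁)) →
    (G₂ : Graph (subsetoid (MetricSpace.setoid 𝕏) V₂)) →
    GEC 𝕏 G₁ → GEC 𝕏 G₂ →
    (ElementarilyEquivalent (graphInd D G₁) (graphInd D G₂)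
    × ElementarilyEquivalent (graphStructure G₁) (graphStructure G₂)
    × ElementarilyEquivalent (vertexInd D V₁) (vertexInd D V₂))
    × (StructureHasQE (vertexInd D V₁) × StructureHasQE (graphInd D G₁))
theorem3p3 em 𝕏 _ _ L D V₁ V₂ ind₁ dense₁ ind₂ dense₂ thickness G₁ G₂ gec₁ gec₂ =
  (graphs≡ , bareGraphs≡ , vertices≡) , (vertexQE , graphQE)
  where
  graphs≡ : ElementarilyEquivalent (graphInd D G₁) (graphInd D G₂)
  graphs≡ σ =
    -- A sentence has no parameters, so the matrix is empty and both graphs reduce to one and the
    -- same 𝓛-sentence evaluated in `M`.
    let nf₁ = graphNF-correct em D thickness ind₁ G₁ gec₁ σ [] (λ ()) (λ ())
        nf₂ = graphNF-correct em D thickness ind₂ G₂ gec₂ σ [] (λ ()) (λ ())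
    in mk⇔ (from nf₂ ∘ to nf₁) (from nf₁ ∘ to nf₂)

  bareGraphs≡ : ElementarilyEquivalent (graphStructure G₁) (graphStructure G₂)
  bareGraphs≡ σ = mk⇔
    (from (⊨-fromLᴳ D G₂ σ []) ∘ to   (graphs≡ (fromLᴳ D σ)) ∘ to (⊨-fromLᴳ D G₁ σ []))
    (from (⊨-fromLᴳ D G₁ σ []) ∘ from (graphs≡ (fromLᴳ D σ)) ∘ to (⊨-fromLᴳ D G₂ σ []))

  vertices≡ : ElementarilyEquivalent (vertexInd D V₁) (vertexInd D V₂)
  vertices≡ σ =
    let nf₁ = vertexNF-correct em D thickness ind₁ dense₁ σ []
        nf₂ = vertexNF-correct em D thickness ind₂ dense₂ σ []
    in mk⇔ (from nf₂ ∘ to nf₁) (from nf₁ ∘ to nf₂)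

  vertexQE : StructureHasQE (vertexInd D V₁)
  vertexQE = structureHasQE (vertexInd D V₁) λ k φ →
    -- The normal form is an 𝓛-formula, hence a relation symbol of `Lind`: a single atom is the
    -- quantifier-free equivalent.
    rel (vertexNF em D thickness φ) vars , rel _ vars , λ v →
      ≡.subst (λ u → (vertexInd D V₁ ⊨ φ [ v ]) ⇔
                     DefiningStructure.Holds D (vertexNF em D thickness φ) (points em D V₁ u))
        (≡.sym (evals-vars (vertexInd D V₁) v))
        (vertexNF-correct em D thickness ind₁ dense₁ φ v)

  graphQE : StructureHasQE (graphInd D G₁)
  graphQE = structureHasQE (graphInd D G₁) λ k φ →
    graphQF em D thickness φ , graphQF-QF em D thickness φ ,
    graphQF-correct em D thickness ind₁ G₁ gec₁ φ
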